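{- Let $\mathcal H=(V,E)$ be a hypergraph with splitting functions, let $R\subseteq V$, $\varepsilon>0$ and $\alpha>0$. Then the set $S_L$ returned by Algorithm 2 satisfies $$S_L\in\arg\min_{S\subseteq V}\mathrm{Hstcut}_\alpha(S).$$
   Context: A hypergraph $\mathcal H=(V,E)$ has a finite node set $V$, and each hyperedge $e\in E$ is a subset of $V$. Each hyperedge $e$ carries a splitting function $w_e:2^e\to\mathbb R_{\ge0}$ satisfying $w_e(A)=w_e(e\setminus A)$ for all $A\subseteq e$ and $w_e(\emptyset)=w_e(e)=0$. For $S\subseteq V$, $\mathrm{cut}_{\mathcal H}(S)=\sum_{e\in E}w_e(e\cap S)$. The degree of $v$ is $d_v=\sum_{e\ni v}w_e(\{v\})$, and $\mathrm{vol}(S)=\sum_{v\in S}d_v$. Write $\bar S=V\setminus S$. For $\alpha>0$, $\mathrm{Hstcut}_\alpha(S)=\mathrm{cut}_{\mathcal H}(S)+\alpha\,\mathrm{vol}(\bar S\cap R)+\alpha\varepsilon\,\mathrm{vol}(S\cap\bar R)$. This is the $s$-$t$ cut value of $S\cup\{s\}$ in the hypergraph $\mathcal H_\alpha$ obtained from $\mathcal H$ by adding terminal edges $(s,r)$ of weight $\alpha d_r$ for $r\in R$ and $(j,t)$ of weight $\alpha\varepsilon d_j$ for $j\in\bar R$. Neighborhood notation: $E(v)=\{e\in E: v\in e\}$ and $E(S)=\bigcup_{v\in S}E(v)$. Also $\mathcal N(v)=\{u: \exists e\in E,\ u,v\in e\}$ and $\mathcal N(S)=\bigcup_{v\in S}\mathcal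 N(v)$. A local hypergraph is given by a node set $V_L\subseteq V$ and a hyperedge set $E_L\subseteq E$, with every $e\in E_L$ contained in $V_L$. Every node of $V_L$ keeps its terminal edge. For $S\subseteq V_L$, its cut value is $$\mathrm{Lstcut}_\alpha(S)=\sum_{e\in E_L}w_e(e\cap S)+\alpha\sum_{v\in V_L\cap R,\,v\notin S}d_v+\alpha\varepsilon\sum_{v\in V_L\cap\bar R,\,v\in S}d_v.$$ Algorithm 2 works as follows. Initialize $V_L=R\cup\mathcal N(R)$, $E_L=E(R)$, and $X=\emptyset$. Then repeat: 1. Compute $S_L\in\arg\min_{S\subseteq V_L}\mathrm{Lstcut}_\alpha(S)$. 2. Set $N=(S_L\cap\bar R)\setminus X$. 3. Update $V_L\leftarrow V_L\cup\mathcal N(N)$, $E_L\leftarrow E_L\cup E(N)$, and $X\leftarrow X\cup N$. Stop when $N=\emptyset$ and return $S_L$. -}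

module Defs where

open import Data.Fin.Base using (Fin; zero; suc)
open import Data.Fin.Properties using (any?)
open import Data.Fin.Subset using (Subset; inside; outside; _⊆_; _∩_; _∪_; _─_; ∁; ⊤; ⊥; ⁅_⁆; Empty; Nonempty)
open import Data.Fin.Subset.Properties using (_∈?_)
open import Data.Nat.Base as ℕ using (ℕ)
import Data.Nat.Properties as ℕ
open import Data.Product.Base using (_×_; _,_; ∃-syntax)
open import Data.Rational.Base as ℚ using (ℚ; 0ℚ; 1ℚ; ½; ∣_∣)
import Data.Rational.Properties as ℚ
open import Data.Rational.Solver using (module +-*-Solver)
open import Data.Vec.Base using ([]; _∷_; tabulate)
open import Function.Base using (_∘_)
open import Function.Definitions using (Injective)
open import Relation.Binary.PropositionalEquality using (_≡_; refl; sym; trans; cong)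
open import Relation.Nullary.Decidable using (Dec; does; _×-dec_)

-- Reals are Cauchy sequences of rationals; their equality is _≈ᴿ_, not _≡_.

Cauchy : (ℕ → ℚ) → Set
Cauchy x = ∀ δ → 0ℚ ℚ.< δ →
  ∃[ N ] (∀ i j → N ℕ.≤ i → N ℕ.≤ j → ∣ x i ℚ.- x j ∣ ℚ.≤ δ)

record ℝ : Set where
  constructor mkℝ
  field
    seq    : ℕ → ℚ
    cauchy : Cauchy seq

open ℝ public

infix 4 _≈ᴿ_ _≤ᴿ_ _<ᴿ_

_≈ᴿ_ : ℝ → ℝ → Set
x ≈ᴿ y = ∀ δ → 0ℚ ℚ.< δ →
  ∃[ N ] (∀ i → N ℕ.≤ i → ∣ seq x i ℚ.- seq y i ∣ ℚ.≤ δ)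

_≤ᴿ_ : ℝ → ℝ → Set
x ≤ᴿ y = ∀ δ → 0ℚ ℚ.< δ →
  ∃[ N ] (∀ i → N ℕ.≤ i → seq x i ℚ.≤ seq y i ℚ.+ δ)

_<ᴿ_ : ℝ → ℝ → Set
x <ᴿ y = ∃[ δ ] (0ℚ ℚ.< δ ×
  ∃[ N ] (∀ i → N ℕ.≤ i → seq x i ℚ.+ δ ℚ.≤ seq y i))

fromℚ : ℚ → ℝ
fromℚ q = mkℝ (λ _ → q) λ δ 0<δ →
  0 , λ _ _ _ _ → ℚ.≤-trans (ℚ.≤-reflexive (cong ∣_∣ (ℚ.+-inverseʳ q))) (ℚ.<⇒≤ 0<δ)

0ᴿ : ℝ
0ᴿ = fromℚ 0ℚ

private abstract
  +-difference : ∀ a b c d → (a ℚ.+ b) ℚ.- (c ℚ.+ d) ≡ (a ℚ.- c) ℚ.+ (b ℚ.- d)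
  +-difference = solve 4 (λ a b c d → (a :+ b) :- (c :+ d) := (a :- c) :+ (b :- d)) refl
    where open +-*-Solver

  *-difference : ∀ a b c d → a ℚ.* b ℚ.- c ℚ.* d ≡ a ℚ.* (b ℚ.- d) ℚ.+ d ℚ.* (a ℚ.- c)
  *-difference = solve 4 (λ a b c d → a :* b :- c :* d := a :* (b :- d) :+ d :* (a :- c)) refl
    where open +-*-Solver

  add-back : ∀ a c → a ≡ (a ℚ.- c) ℚ.+ c
  add-back = solve 2 (λ a c → a := (a :- c) :+ c) refl
    where open +-*-Solver

  +-cauchy : ∀ {x y} → Cauchy x → Cauchy y → Cauchy (λ i → x i ℚ.+ y i)
  +-cauchy {x} {y} cx cy δ 0<δ
    with 0<δ½ ← ℚ.positive⁻¹ (δ ℚ.* ½) {{ℚ.pos*pos⇒pos δ {{ℚ.positive 0<δ}} ½}}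
    with cx (δ ℚ.* ½) 0<δ½ | cy (δ ℚ.* ½) 0<δ½
  ... | Mx , bx | My , by = Mx ℕ.⊔ My , bound
    where
    open ℚ.≤-Reasoning

    bound : ∀ i j → Mx ℕ.⊔ My ℕ.≤ i → Mx ℕ.⊔ My ℕ.≤ j →
            ∣ (x i ℚ.+ y i) ℚ.- (x j ℚ.+ y j) ∣ ℚ.≤ δ
    bound i j N≤i N≤j = begin
      ∣ (x i ℚ.+ y i) ℚ.- (x j ℚ.+ y j) ∣
        ≡⟨ cong ∣_∣ (+-difference (x i) (y i) (x j) (y j)) ⟩
      ∣ (x i ℚ.- x j) ℚ.+ (y i ℚ.- y j) ∣
        ≤⟨ ℚ.∣p+q∣≤∣p∣+∣q∣ (x i ℚ.- x j) (y i ℚ.- y j) ⟩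
      ∣ x i ℚ.- x j ∣ ℚ.+ ∣ y i ℚ.- y j ∣
        ≤⟨ ℚ.+-mono-≤
             (bx i j (ℕ.m⊔n≤o⇒m≤o Mx My N≤i) (ℕ.m⊔n≤o⇒m≤o Mx My N≤j))
             (by i j (ℕ.m⊔n≤o⇒n≤o Mx My N≤i) (ℕ.m⊔n≤o⇒n≤o Mx My N≤j)) ⟩
      δ ℚ.* ½ ℚ.+ δ ℚ.* ½
        ≡⟨ sym (ℚ.*-distribˡ-+ δ ½ ½) ⟩
      δ ℚ.* 1ℚ
        ≡⟨ ℚ.*-identityʳ δ ⟩
      δ ∎

  cauchy⇒bounded : ∀ {x} → Cauchy x →
    ∃[ B ] (0ℚ ℚ.< B × ∃[ N ] (∀ i → N ℕ.≤ i → ∣ x i ∣ ℚ.≤ B))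
  cauchy⇒bounded {x} cx with cx 1ℚ (ℚ.positive⁻¹ 1ℚ)
  ... | N , b = 1ℚ ℚ.+ ∣ x N ∣ , 0<B , N , bound
    where
    open ℚ.≤-Reasoning

    0<B : 0ℚ ℚ.< 1ℚ ℚ.+ ∣ x N ∣
    0<B = ℚ.+-mono-<-≤ (ℚ.positive⁻¹ 1ℚ) (ℚ.0≤∣p∣ (x N))

    bound : ∀ i → N ℕ.≤ i → ∣ x i ∣ ℚ.≤ 1ℚ ℚ.+ ∣ x N ∣
    bound i N≤i = begin
      ∣ x i ∣
        ≡⟨ cong ∣_∣ (add-back (x i) (x N)) ⟩
      ∣ (x i ℚ.- x N) ℚ.+ x N ∣
        ≤⟨ ℚ.∣p+q∣≤∣p∣+∣q∣ (x i ℚ.- x N) (x N) ⟩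
      ∣ x i ℚ.- x N ∣ ℚ.+ ∣ x N ∣
        ≤⟨ ℚ.+-monoˡ-≤ ∣ x N ∣ (b i N N≤i ℕ.≤-refl) ⟩
      1ℚ ℚ.+ ∣ x N ∣ ∎

  ∣*∣-mono : ∀ {p q B d} → 0ℚ ℚ.< B → ∣ p ∣ ℚ.≤ B → ∣ q ∣ ℚ.≤ d → ∣ p ℚ.* q ∣ ℚ.≤ B ℚ.* d
  ∣*∣-mono {p} {q} {B} {d} 0<B p≤B q≤d = begin
    ∣ p ℚ.* q ∣       ≡⟨ ℚ.∣p*q∣≡∣p∣*∣q∣ p q ⟩
    ∣ p ∣ ℚ.* ∣ q ∣   ≤⟨ ℚ.*-monoʳ-≤-nonNeg ∣ q ∣ {{ℚ.nonNegative (ℚ.0≤∣p∣ q)}} p≤B ⟩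
    B ℚ.* ∣ q ∣       ≤⟨ ℚ.*-monoˡ-≤-nonNeg B {{ℚ.nonNegative (ℚ.<⇒≤ 0<B)}} q≤d ⟩
    B ℚ.* d           ∎
    where open ℚ.≤-Reasoning

  quotient : ∀ {C δ} → 0ℚ ℚ.< C → 0ℚ ℚ.< δ → ∃[ η ] (0ℚ ℚ.< η × C ℚ.* η ≡ δ)
  quotient {C} {δ} 0<C 0<δ = ℚ.1/ C ℚ.* δ , 0<η , C*η≡δ
    where
    instance
      C-pos : ℚ.Positive C
      C-pos = ℚ.positive 0<C
      C-nonZero : ℚ.NonZero C
      C-nonZero = ℚ.pos⇒nonZero C

    0<η : 0ℚ ℚ.< ℚ.1/ C ℚ.* δ
    0<η = ℚ.positive⁻¹ (ℚ.1/ C ℚ.* δ) {{ℚ.pos*pos⇒pos (ℚ.1/ C) {{ℚ.1/pos⇒pos C}} δ {{ℚ.positive 0<δ}}}}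

    C*η≡δ : C ℚ.* (ℚ.1/ C ℚ.* δ) ≡ δ
    C*η≡δ = trans (sym (ℚ.*-assoc C (ℚ.1/ C) δ))
              (trans (cong (ℚ._* δ) (ℚ.*-inverseʳ C)) (ℚ.*-identityˡ δ))

  *-bound : ∀ {Bx By η δ} a b c d → 0ℚ ℚ.< Bx → 0ℚ ℚ.< By → (Bx ℚ.+ By) ℚ.* η ≡ δ →
    ∣ a ∣ ℚ.≤ Bx → ∣ d ∣ ℚ.≤ By → ∣ a ℚ.- c ∣ ℚ.≤ η → ∣ b ℚ.- d ∣ ℚ.≤ η →
    ∣ a ℚ.* b ℚ.- c ℚ.* d ∣ ℚ.≤ δ
  *-bound {Bx} {By} {η} {δ} a b c d 0<Bx 0<By C*η≡δ a≤ d≤ ac≤ bd≤ = begin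
    ∣ a ℚ.* b ℚ.- c ℚ.* d ∣
      ≡⟨ cong ∣_∣ (*-difference a b c d) ⟩
    ∣ a ℚ.* (b ℚ.- d) ℚ.+ d ℚ.* (a ℚ.- c) ∣
      ≤⟨ ℚ.∣p+q∣≤∣p∣+∣q∣ (a ℚ.* (b ℚ.- d)) (d ℚ.* (a ℚ.- c)) ⟩
    ∣ a ℚ.* (b ℚ.- d) ∣ ℚ.+ ∣ d ℚ.* (a ℚ.- c) ∣
      ≤⟨ ℚ.+-mono-≤ (∣*∣-mono {a} {b ℚ.- d} 0<Bx a≤ bd≤) (∣*∣-mono {d} {a ℚ.- c} 0<By d≤ ac≤) ⟩
    Bx ℚ.* η ℚ.+ By ℚ.* η
      ≡⟨ sym (ℚ.*-distribʳ-+ η Bx By) ⟩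
    (Bx ℚ.+ By) ℚ.* η
      ≡⟨ C*η≡δ ⟩
    δ ∎
    where open ℚ.≤-Reasoning

  *-cauchy : ∀ {x y} → Cauchy x → Cauchy y → Cauchy (λ i → x i ℚ.* y i)
  *-cauchy {x} {y} cx cy δ 0<δ =
    let Bx , 0<Bx , Kx , ∣x∣≤Bx = cauchy⇒bounded cx
        By , 0<By , Ky , ∣y∣≤By = cauchy⇒bounded cy
        η , 0<η , C*η≡δ = quotient (ℚ.+-mono-< 0<Bx 0<By) 0<δ
        Nx , bx = cx η 0<η
        Ny , by = cy η 0<η
        K = Kx ℕ.⊔ Ky
        N = Nx ℕ.⊔ Ny
    in K ℕ.⊔ N , λ i j ≤i ≤j →
      let N≤i = ℕ.m⊔n≤o⇒n≤o K N ≤i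
          N≤j = ℕ.m⊔n≤o⇒n≤o K N ≤j
      in *-bound (x i) (y i) (x j) (y j) 0<Bx 0<By C*η≡δ
           (∣x∣≤Bx i (ℕ.m⊔n≤o⇒m≤o Kx Ky (ℕ.m⊔n≤o⇒m≤o K N ≤i)))
           (∣y∣≤By j (ℕ.m⊔n≤o⇒n≤o Kx Ky (ℕ.m⊔n≤o⇒m≤o K N ≤j)))
           (bx i j (ℕ.m⊔n≤o⇒m≤o Nx Ny N≤i) (ℕ.m⊔n≤o⇒m≤o Nx Ny N≤j))
           (by i j (ℕ.m⊔n≤o⇒n≤o Nx Ny N≤i) (ℕ.m⊔n≤o⇒n≤o Nx Ny N≤j))

infixl 6 _+ᴿ_
infixl 7 _*ᴿ_

_+ᴿ_ : ℝ → ℝ → ℝ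
x +ᴿ y = mkℝ (λ i → seq x i ℚ.+ seq y i) (+-cauchy {seq x} {seq y} (cauchy x) (cauchy y))

_*ᴿ_ : ℝ → ℝ → ℝ
x *ᴿ y = mkℝ (λ i → seq x i ℚ.* seq y i) (*-cauchy {seq x} {seq y} (cauchy x) (cauchy y))

sumOver : ∀ {k} → Subset k → (Fin k → ℝ) → ℝ
sumOver []            f = 0ᴿ
sumOver (inside  ∷ p) f = f zero +ᴿ sumOver p (f ∘ suc)
sumOver (outside ∷ p) f = sumOver p (f ∘ suc)

unionOver : ∀ {k l} → Subset k → (Fin k → Subset l) → Subset l
unionOver []            F = ⊥
unionOver (inside  ∷ p) F = F zero ∪ unionOver p (F ∘ suc)
unionOver (outside ∷ p) F = unionOver p (F ∘ suc)

comprehension : ∀ {k} {P : Fin k → Set} → (∀ i → Dec (P i)) → Subset k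
comprehension P? = tabulate (does ∘ P?)

_∈argmin[_]_ : ∀ {k} → Subset k → Subset k → (Subset k → ℝ) → Set
S ∈argmin[ U ] f = S ⊆ U × (∀ T → T ⊆ U → f S ≤ᴿ f T)

-- V = Fin n, and E is enumerated without repetition by Fin m.  The function
-- w i plays the role of w_e : 2^e → ℝ≥0 for e = edge i: only its values on
-- subsets of e are constrained, and only these are ever used.
record Hypergraph (n m : ℕ) : Set where
  field
    edge           : Fin m → Subset n
    edge-injective : Injective _≡_ _≡_ edge
    w              : Fin m → Subset n → ℝ
    w-nonneg       : ∀ i A → A ⊆ edge i → 0ᴿ ≤ᴿ w i A
    w-symmetric    : ∀ i A → A ⊆ edge i → w i A ≈ᴿ w i (edge i ─ A)
    w-∅            : ∀ i → w i ⊥ ≈ᴿ 0ᴿ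
    w-full         : ∀ i → w i (edge i) ≈ᴿ 0ᴿ

module _ {n m : ℕ} (H : Hypergraph n m) where
  open Hypergraph H

  cut : Subset n → ℝ
  cut S = sumOver ⊤ (λ i → w i (edge i ∩ S))

  incident : Fin n → Subset m
  incident v = comprehension (λ i → v ∈? edge i)

  incidentTo : Subset n → Subset m
  incidentTo S = unionOver S incident

  -- As in the definition of 𝒩(v), v itself is included iff it lies in a hyperedge.
  neighbours : Fin n → Subset n
  neighbours v = comprehension (λ u → any? (λ i → (u ∈? edge i) ×-dec (v ∈? edge i)))

  neighboursOf : Subset n → Subset n
  neighboursOf S = unionOver S neighbours

  degree : Fin n → ℝ
  degree v = sumOver (incident v) (λ i → w i ⁅ v ⁆)

  vol : Subset n → ℝ
  vol S = sumOver S degree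

  module _ (R : Subset n) (ε α : ℝ) where

    Hstcut : Subset n → ℝ
    Hstcut S = cut S +ᴿ α *ᴿ vol (∁ S ∩ R) +ᴿ α *ᴿ ε *ᴿ vol (S ∩ ∁ R)

    record State : Set where
      constructor ⟨_,_,_⟩
      field
        V_L : Subset n
        E_L : Subset m
        X   : Subset n

    open State

    Lstcut : State → Subset n → ℝ
    Lstcut σ S = sumOver (E_L σ) (λ i → w i (edge i ∩ S))
      +ᴿ α *ᴿ sumOver ((V_L σ ∩ R) ∩ ∁ S) degree
      +ᴿ α *ᴿ ε *ᴿ sumOver ((V_L σ ∩ ∁ R) ∩ S) degree

    initial : State
    initial = ⟨ R ∪ neighboursOf R , incidentTo R , ⊥ ⟩

    newNodes : State → Subset n → Subset n
    newNodes σ S = (S ∩ ∁ R) ─ X σ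

    expand : State → Subset n → State
    expand σ N = ⟨ V_L σ ∪ neighboursOf N , E_L σ ∪ incidentTo N , X σ ∪ N ⟩

    -- σ ⇓ S: some execution of the loop from state σ returns S.  The choice of
    -- minimiser in each iteration is arbitrary.
    data _⇓_ (σ : State) : Subset n → Set where
      stop : ∀ {S} → S ∈argmin[ V_L σ ] Lstcut σ →
             Empty (newNodes σ S) → σ ⇓ S
      loop : ∀ {S T} → S ∈argmin[ V_L σ ] Lstcut σ →
             Nonempty (newNodes σ S) → expand σ (newNodes σ S) ⇓ T → σ ⇓ T

    Algorithm2Returns : Subset n → Set
    Algorithm2Returns S = initial ⇓ S

{-# OPTIONS --safe #-}
-- Let S be the returned set and (V_L , E_L , X) the state in which the loop
-- stops.  Then S ⊆ R ∪ X, so every hyperedge meeting S already lies in E_L and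
-- the global and local cut values of S agree.  Conversely, for any T the local
-- cut value of T ∩ V_L is at most the global cut value of T: hyperedges of E_L
-- lie inside V_L and contribute equally, R ⊆ V_L, and all other global terms
-- are nonnegative.  Hence
--   Hstcut S ≤ Lstcut S ≤ Lstcut (T ∩ V_L) ≤ Hstcut T.
module Submission where

open import Data.Fin.Base using (Fin; zero; suc)
open import Data.Fin.Properties using (any?)
open import Data.Fin.Subset using (Subset; inside; outside; _∈_; _∉_; _⊆_; _∩_; _∪_; ∁; ⊤; ⊥; ⁅_⁆; Empty)
open import Data.Fin.Subset.Properties
open import Data.Nat.Base as ℕ using (ℕ)
import Data.Nat.Properties as ℕ
open import Data.Product.Base using (_×_; _,_; ∃-syntax; proj₂)
open import Data.Rational.Base as ℚ using (ℚ; 0ℚ; 1ℚ; ½; ∣_∣)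
import Data.Rational.Properties as ℚ
open import Data.Rational.Solver using (module +-*-Solver)
open import Data.Sum.Base using (inj₁; inj₂; [_,_]′)
open import Data.Vec.Base using ([]; _∷_; here; there)
open import Data.Vec.Properties using (lookup⇒[]=; []=⇒lookup; lookup∘tabulate)
open import Function.Base using (_∘_)
open import Relation.Binary.PropositionalEquality using (_≡_; refl; sym; trans; cong; subst)
open import Relation.Nullary using (Dec; yes; no; does; contradiction)
open import Relation.Nullary.Decidable using (dec-true; _×-dec_)
open import Defs

-- Order on the reals

halve : ∀ {δ} → 0ℚ ℚ.< δ → ∃[ η ] (0ℚ ℚ.< η × η ℚ.+ η ≡ δ)
halve {δ} 0<δ = δ ℚ.* ½ ,
  ℚ.positive⁻¹ (δ ℚ.* ½) {{ℚ.pos*pos⇒pos δ {{ℚ.positive 0<δ}} ½}} ,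
  trans (sym (ℚ.*-distribˡ-+ δ ½ ½)) (ℚ.*-identityʳ δ)

p≤∣p∣ : ∀ p → p ℚ.≤ ∣ p ∣
p≤∣p∣ p with ℚ.≤-total 0ℚ p
... | inj₁ 0≤p = ℚ.≤-reflexive (sym (ℚ.0≤p⇒∣p∣≡p 0≤p))
... | inj₂ p≤0 = ℚ.≤-trans p≤0 (ℚ.0≤∣p∣ p)

≤ᴿ-refl : ∀ x → x ≤ᴿ x
≤ᴿ-refl x δ 0<δ = 0 , λ i _ → ℚ.≤-trans
  (ℚ.≤-reflexive (sym (ℚ.+-identityʳ (seq x i))))
  (ℚ.+-monoʳ-≤ (seq x i) (ℚ.<⇒≤ 0<δ))

≤ᴿ-reflexive : ∀ {x y} → x ≡ y → x ≤ᴿ y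
≤ᴿ-reflexive {x} refl = ≤ᴿ-refl x

≤ᴿ-trans : ∀ x y z → x ≤ᴿ y → y ≤ᴿ z → x ≤ᴿ z
≤ᴿ-trans x y z x≤y y≤z δ 0<δ with halve 0<δ
... | η , 0<η , η+η≡δ with x≤y η 0<η | y≤z η 0<η
... | M , xy | N , yz = M ℕ.⊔ N , λ i ≤i → begin
    seq x i                  ≤⟨ xy i (ℕ.m⊔n≤o⇒m≤o M N ≤i) ⟩
    seq y i ℚ.+ η            ≤⟨ ℚ.+-monoˡ-≤ η (yz i (ℕ.m⊔n≤o⇒n≤o M N ≤i)) ⟩
    seq z i ℚ.+ η ℚ.+ η      ≡⟨ ℚ.+-assoc (seq z i) η η ⟩
    seq z i ℚ.+ (η ℚ.+ η)    ≡⟨ cong (seq z i ℚ.+_) η+η≡δ ⟩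
    seq z i ℚ.+ δ            ∎
  where open ℚ.≤-Reasoning

≈ᴿ⇒≤ᴿ : ∀ x y → x ≈ᴿ y → x ≤ᴿ y
≈ᴿ⇒≤ᴿ x y x≈y δ 0<δ with x≈y δ 0<δ
... | N , close = N , λ i N≤i → begin
    seq x i                            ≡⟨ split (seq x i) (seq y i) ⟩
    seq y i ℚ.+ (seq x i ℚ.- seq y i)  ≤⟨ ℚ.+-monoʳ-≤ (seq y i) (p≤∣p∣ (seq x i ℚ.- seq y i)) ⟩
    seq y i ℚ.+ ∣ seq x i ℚ.- seq y i ∣ ≤⟨ ℚ.+-monoʳ-≤ (seq y i) (close i N≤i) ⟩
    seq y i ℚ.+ δ                      ∎
  where
  open ℚ.≤-Reasoning

  split : ∀ a b → a ≡ b ℚ.+ (a ℚ.- b)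
  split = solve 2 (λ a b → a := b :+ (a :- b)) refl
    where open +-*-Solver

+ᴿ-mono-≤ᴿ : ∀ x y u v → x ≤ᴿ y → u ≤ᴿ v → x +ᴿ u ≤ᴿ y +ᴿ v
+ᴿ-mono-≤ᴿ x y u v x≤y u≤v δ 0<δ with halve 0<δ
... | η , 0<η , η+η≡δ with x≤y η 0<η | u≤v η 0<η
... | M , xy | N , uv = M ℕ.⊔ N , λ i ≤i → begin
    seq x i ℚ.+ seq u i
      ≤⟨ ℚ.+-mono-≤ (xy i (ℕ.m⊔n≤o⇒m≤o M N ≤i)) (uv i (ℕ.m⊔n≤o⇒n≤o M N ≤i)) ⟩
    (seq y i ℚ.+ η) ℚ.+ (seq v i ℚ.+ η)
      ≡⟨ regroup (seq y i) (seq v i) η ⟩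
    seq y i ℚ.+ seq v i ℚ.+ (η ℚ.+ η)
      ≡⟨ cong (seq y i ℚ.+ seq v i ℚ.+_) η+η≡δ ⟩
    seq y i ℚ.+ seq v i ℚ.+ δ ∎
  where
  open ℚ.≤-Reasoning

  regroup : ∀ a b c → (a ℚ.+ c) ℚ.+ (b ℚ.+ c) ≡ a ℚ.+ b ℚ.+ (c ℚ.+ c)
  regroup = solve 3 (λ a b c → (a :+ c) :+ (b :+ c) := a :+ b :+ (c :+ c)) refl
    where open +-*-Solver

-- If the terms are eventually at least `δ` and `η`, their products are eventually at least `δ * η`.
-- This gives positivity of the coefficient `α *ᴿ ε`.
0<ᴿ-* : ∀ x y → 0ᴿ <ᴿ x → 0ᴿ <ᴿ y → 0ᴿ <ᴿ x *ᴿ y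
0<ᴿ-* x y (δ , 0<δ , M , δ≤x) (η , 0<η , N , η≤y) =
  δ ℚ.* η , ℚ.positive⁻¹ (δ ℚ.* η) {{ℚ.pos*pos⇒pos δ η}} , M ℕ.⊔ N , λ i ≤i → begin
    0ℚ ℚ.+ δ ℚ.* η
      ≡⟨ ℚ.+-identityˡ (δ ℚ.* η) ⟩
    δ ℚ.* η
      ≤⟨ ℚ.*-monoˡ-≤-nonNeg δ (lower η (seq y i) (η≤y i (ℕ.m⊔n≤o⇒n≤o M N ≤i))) ⟩
    δ ℚ.* seq y i
      ≤⟨ ℚ.*-monoʳ-≤-nonNeg (seq y i)
           {{ℚ.nonNegative (ℚ.≤-trans (ℚ.<⇒≤ 0<η) (lower η (seq y i) (η≤y i (ℕ.m⊔n≤o⇒n≤o M N ≤i))))}}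
           (lower δ (seq x i) (δ≤x i (ℕ.m⊔n≤o⇒m≤o M N ≤i))) ⟩
    seq x i ℚ.* seq y i ∎
  where
  open ℚ.≤-Reasoning
  instance
    δ-pos : ℚ.Positive δ
    δ-pos = ℚ.positive 0<δ
    η-pos : ℚ.Positive η
    η-pos = ℚ.positive 0<η
    δ-nonNeg : ℚ.NonNegative δ
    δ-nonNeg = ℚ.nonNegative (ℚ.<⇒≤ 0<δ)

  lower : ∀ a b → 0ℚ ℚ.+ a ℚ.≤ b → a ℚ.≤ b
  lower a b = subst (ℚ._≤ b) (ℚ.+-identityˡ a)

eventually-bounded : ∀ x → 0ᴿ <ᴿ x →
  ∃[ B ] (0ℚ ℚ.< B × ∃[ N ] (∀ i → N ℕ.≤ i → 0ℚ ℚ.≤ seq x i × seq x i ℚ.≤ B))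
eventually-bounded x (δ , 0<δ , M , δ≤x) with cauchy x 1ℚ (ℚ.positive⁻¹ 1ℚ)
... | K , close = B , 0<B , M ℕ.⊔ K , λ i ≤i →
    nonneg i (ℕ.m⊔n≤o⇒m≤o M K ≤i) , bound i (ℕ.m⊔n≤o⇒n≤o M K ≤i)
  where
  open ℚ.≤-Reasoning

  -- From index `K` on, every term lies within 1 of `seq x K`.
  B : ℚ
  B = 1ℚ ℚ.+ ∣ seq x K ∣

  0<B : 0ℚ ℚ.< B
  0<B = ℚ.+-mono-<-≤ (ℚ.positive⁻¹ 1ℚ) (ℚ.0≤∣p∣ (seq x K))

  nonneg : ∀ i → M ℕ.≤ i → 0ℚ ℚ.≤ seq x i
  nonneg i M≤i = ℚ.≤-trans (ℚ.<⇒≤ 0<δ)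
    (subst (ℚ._≤ seq x i) (ℚ.+-identityˡ δ) (δ≤x i M≤i))

  split : ∀ a b → a ≡ (a ℚ.- b) ℚ.+ b
  split = solve 2 (λ a b → a := (a :- b) :+ b) refl
    where open +-*-Solver

  bound : ∀ i → K ℕ.≤ i → seq x i ℚ.≤ B
  bound i K≤i = begin
    seq x i                             ≡⟨ split (seq x i) (seq x K) ⟩
    (seq x i ℚ.- seq x K) ℚ.+ seq x K   ≤⟨ ℚ.+-mono-≤
      (ℚ.≤-trans (p≤∣p∣ (seq x i ℚ.- seq x K)) (close i K K≤i ℕ.≤-refl)) (p≤∣p∣ (seq x K)) ⟩
    B                                   ∎

divide : ∀ {B δ} → 0ℚ ℚ.< B → 0ℚ ℚ.< δ → ∃[ η ] (0ℚ ℚ.< η × B ℚ.* η ≡ δ)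
divide {B} {δ} 0<B 0<δ = ℚ.1/ B ℚ.* δ , 0<η , B*η≡δ
  where
  instance
    B-pos : ℚ.Positive B
    B-pos = ℚ.positive 0<B
    B-nonZero : ℚ.NonZero B
    B-nonZero = ℚ.pos⇒nonZero B

  0<η : 0ℚ ℚ.< ℚ.1/ B ℚ.* δ
  0<η = ℚ.positive⁻¹ (ℚ.1/ B ℚ.* δ)
    {{ℚ.pos*pos⇒pos (ℚ.1/ B) {{ℚ.1/pos⇒pos B}} δ {{ℚ.positive 0<δ}}}}

  B*η≡δ : B ℚ.* (ℚ.1/ B ℚ.* δ) ≡ δ
  B*η≡δ = trans (sym (ℚ.*-assoc B (ℚ.1/ B) δ))
    (trans (cong (ℚ._* δ) (ℚ.*-inverseʳ B)) (ℚ.*-identityˡ δ))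

-- Scaling by `p` also scales the slack; since `p` is at most `B`, an initial slack of `δ / B` grows
-- to at most `δ`.
*-mono-≤-slack : ∀ {B η δ p q r} → 0ℚ ℚ.< η → B ℚ.* η ≡ δ → 0ℚ ℚ.≤ p → p ℚ.≤ B →
  q ℚ.≤ r ℚ.+ η → p ℚ.* q ℚ.≤ p ℚ.* r ℚ.+ δ
*-mono-≤-slack {B} {η} {δ} {p} {q} {r} 0<η B*η≡δ 0≤p p≤B q≤ = begin
  p ℚ.* q               ≤⟨ ℚ.*-monoˡ-≤-nonNeg p {{ℚ.nonNegative 0≤p}} q≤ ⟩
  p ℚ.* (r ℚ.+ η)       ≡⟨ ℚ.*-distribˡ-+ p r η ⟩
  p ℚ.* r ℚ.+ p ℚ.* η   ≤⟨ ℚ.+-monoʳ-≤ (p ℚ.* r)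
                             (ℚ.*-monoʳ-≤-nonNeg η {{ℚ.nonNegative (ℚ.<⇒≤ 0<η)}} p≤B) ⟩
  p ℚ.* r ℚ.+ B ℚ.* η   ≡⟨ cong (p ℚ.* r ℚ.+_) B*η≡δ ⟩
  p ℚ.* r ℚ.+ δ         ∎
  where open ℚ.≤-Reasoning

-- Strict positivity of `a` makes its terms nonnegative and bounded from some index on, so the
-- inequality can be multiplied term by term with controlled slack.
*ᴿ-monoʳ-≤ᴿ : ∀ a x y → 0ᴿ <ᴿ a → x ≤ᴿ y → a *ᴿ x ≤ᴿ a *ᴿ y
*ᴿ-monoʳ-≤ᴿ a x y 0<a x≤y δ 0<δ =
  let B , 0<B , M , a-bounds = eventually-bounded a 0<a
      η , 0<η , B*η≡δ = divide 0<B 0<δ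
      N , xy = x≤y η 0<η
  in M ℕ.⊔ N , λ i ≤i →
    let 0≤a , a≤B = a-bounds i (ℕ.m⊔n≤o⇒m≤o M N ≤i)
    in *-mono-≤-slack {p = seq a i} {seq x i} {seq y i} 0<η B*η≡δ 0≤a a≤B (xy i (ℕ.m⊔n≤o⇒n≤o M N ≤i))

-- Sums, unions and comprehensions over finite subsets

-- An index missing from one of the sets counts as a zero term there. This form compares a sum over
-- all hyperedges with one over the local hyperedges, in either direction.
sumOver-mono : ∀ {k} (p q : Subset k) (f g : Fin k → ℝ) →
  (∀ i → i ∈ p → i ∈ q → f i ≤ᴿ g i) →
  (∀ i → i ∈ p → i ∉ q → f i ≤ᴿ 0ᴿ) →
  (∀ i → i ∉ p → i ∈ q → 0ᴿ ≤ᴿ g i) →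
  sumOver p f ≤ᴿ sumOver q g
sumOver-mono [] [] f g both left right = ≤ᴿ-refl 0ᴿ
sumOver-mono (s ∷ p) (t ∷ q) f g both left right = step s t both left right
  where
  F G : ℝ
  F = sumOver p (f ∘ suc)
  G = sumOver q (g ∘ suc)

  F≤G : F ≤ᴿ G
  F≤G = sumOver-mono p q (f ∘ suc) (g ∘ suc)
    (λ i i∈p i∈q → both (suc i) (there i∈p) (there i∈q))
    (λ i i∈p i∉q → left (suc i) (there i∈p) (i∉q ∘ drop-there))
    (λ i i∉p i∈q → right (suc i) (i∉p ∘ drop-there) (there i∈q))

  x≤0+x : ∀ x → x ≤ᴿ 0ᴿ +ᴿ x
  x≤0+x x δ 0<δ = 0 , λ i _ → subst (λ z → seq x i ℚ.≤ z ℚ.+ δ) (sym (ℚ.+-identityˡ (seq x i)))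
    (proj₂ (≤ᴿ-refl x δ 0<δ) i ℕ.z≤n)

  0+x≤x : ∀ x → 0ᴿ +ᴿ x ≤ᴿ x
  0+x≤x x δ 0<δ = 0 , λ i _ → subst (ℚ._≤ seq x i ℚ.+ δ) (sym (ℚ.+-identityˡ (seq x i)))
    (proj₂ (≤ᴿ-refl x δ 0<δ) i ℕ.z≤n)

  -- The heads `s` and `t` are generalised together with the hypotheses, so that matching on them
  -- refines the memberships as well.
  step : ∀ s t → (∀ i → i ∈ s ∷ p → i ∈ t ∷ q → f i ≤ᴿ g i) →
         (∀ i → i ∈ s ∷ p → i ∉ t ∷ q → f i ≤ᴿ 0ᴿ) →
         (∀ i → i ∉ s ∷ p → i ∈ t ∷ q → 0ᴿ ≤ᴿ g i) →
         sumOver (s ∷ p) f ≤ᴿ sumOver (t ∷ q) g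
  step inside  inside  both left right =
    +ᴿ-mono-≤ᴿ (f zero) (g zero) F G (both zero here here) F≤G
  step inside  outside both left right =
    -- An index in only one set is paired with an inserted zero summand on the other side.
    ≤ᴿ-trans (f zero +ᴿ F) (0ᴿ +ᴿ G) G
      (+ᴿ-mono-≤ᴿ (f zero) 0ᴿ F G (left zero here λ ()) F≤G) (0+x≤x G)
  step outside inside  both left right =
    ≤ᴿ-trans F (0ᴿ +ᴿ F) (g zero +ᴿ G) (x≤0+x F)
      (+ᴿ-mono-≤ᴿ 0ᴿ (g zero) F G (right zero (λ ()) here) F≤G)
  step outside outside both left right = F≤G

sumOver-mono-⊆ : ∀ {k} (p q : Subset k) (f : Fin k → ℝ) →
  (∀ i → 0ᴿ ≤ᴿ f i) → p ⊆ q → sumOver p f ≤ᴿ sumOver q f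
sumOver-mono-⊆ p q f 0≤f p⊆q = sumOver-mono p q f f
  (λ i _ _ → ≤ᴿ-refl (f i))
  (λ i i∈p i∉q → contradiction (p⊆q i∈p) i∉q)
  (λ i _ _ → 0≤f i)

sumOver-nonneg : ∀ {k} (p : Subset k) (f : Fin k → ℝ) →
  (∀ i → i ∈ p → 0ᴿ ≤ᴿ f i) → 0ᴿ ≤ᴿ sumOver p f
sumOver-nonneg p f 0≤f = subst (_≤ᴿ sumOver p f) (sumOver-⊥ f)
  (sumOver-mono ⊥ p f f
    (λ i i∈⊥ _ → contradiction i∈⊥ ∉⊥)
    (λ i i∈⊥ _ → contradiction i∈⊥ ∉⊥)
    (λ i _ → 0≤f i))
  where
  sumOver-⊥ : ∀ {k} (f : Fin k → ℝ) → sumOver ⊥ f ≡ 0ᴿ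
  sumOver-⊥ {ℕ.zero}  f = refl
  sumOver-⊥ {ℕ.suc k} f = sumOver-⊥ (f ∘ suc)

∈-comprehension⁺ : ∀ {k} {P : Fin k → Set} (P? : ∀ i → Dec (P i)) {i} →
  P i → i ∈ comprehension P?
∈-comprehension⁺ P? {i} Pi = lookup⇒[]= i _ (trans (lookup∘tabulate (does ∘ P?) i) (dec-true (P? i) Pi))

∈-comprehension⁻ : ∀ {k} {P : Fin k → Set} (P? : ∀ i → Dec (P i)) {i} →
  i ∈ comprehension P? → P i
∈-comprehension⁻ P? {i} i∈ with P? i | trans (sym (lookup∘tabulate (does ∘ P?) i)) ([]=⇒lookup i∈)
... | yes Pi | _  = Pi
... | no  _  | ()

∈-unionOver⁺ : ∀ {k l} (p : Subset k) (F : Fin k → Subset l) {j x} →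
  j ∈ p → x ∈ F j → x ∈ unionOver p F
∈-unionOver⁺ (inside  ∷ p) F here        x∈ = x∈p∪q⁺ (inj₁ x∈)
∈-unionOver⁺ (inside  ∷ p) F (there j∈p) x∈ = x∈p∪q⁺ (inj₂ (∈-unionOver⁺ p (F ∘ suc) j∈p x∈))
∈-unionOver⁺ (outside ∷ p) F (there j∈p) x∈ = ∈-unionOver⁺ p (F ∘ suc) j∈p x∈

∈-unionOver⁻ : ∀ {k l} (p : Subset k) (F : Fin k → Subset l) {x} →
  x ∈ unionOver p F → ∃[ j ] (j ∈ p × x ∈ F j)
∈-unionOver⁻ []            F x∈ = contradiction x∈ ∉⊥
∈-unionOver⁻ (inside  ∷ p) F x∈ with x∈p∪q⁻ (F zero) _ x∈
... | inj₁ x∈F = zero , here , x∈F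
... | inj₂ x∈U with ∈-unionOver⁻ p (F ∘ suc) x∈U
...   | j , j∈p , x∈Fj = suc j , there j∈p , x∈Fj
∈-unionOver⁻ (outside ∷ p) F x∈ with ∈-unionOver⁻ p (F ∘ suc) x∈
... | j , j∈p , x∈Fj = suc j , there j∈p , x∈Fj

-- Local and global cuts

module _ {n m : ℕ} (H : Hypergraph n m) where
  open Hypergraph H

  ∈-incidentTo⁺ : ∀ S {v i} → v ∈ S → v ∈ edge i → i ∈ incidentTo H S
  ∈-incidentTo⁺ S {v} v∈S v∈e =
    ∈-unionOver⁺ S (incident H) v∈S (∈-comprehension⁺ (λ i → v ∈? edge i) v∈e)

  -- A hyperedge of E(S) contains some `v` in `S`, and all its nodes are neighbours of `v`. Hence
  -- enlarging the node set by 𝒩(N) makes room for every hyperedge of E(N).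
  edge⊆neighboursOf : ∀ S {i} → i ∈ incidentTo H S → edge i ⊆ neighboursOf H S
  edge⊆neighboursOf S {i} i∈ {u} u∈e with ∈-unionOver⁻ S (incident H) i∈
  ... | v , v∈S , i∈v = ∈-unionOver⁺ S (neighbours H) v∈S
    (∈-comprehension⁺ (λ u → any? (λ i → (u ∈? edge i) ×-dec (v ∈? edge i)))
      (i , u∈e , ∈-comprehension⁻ (λ i → v ∈? edge i) i∈v))

  degree-nonneg : ∀ v → 0ᴿ ≤ᴿ degree H v
  degree-nonneg v = sumOver-nonneg (incident H v) (λ i → w i ⁅ v ⁆) λ i i∈v →
    -- Nonnegativity is available only on subsets of `edge i`; the singleton is one because `i` is
    -- incident to `v`.
    w-nonneg i ⁅ v ⁆ λ u∈⁅v⁆ →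
      subst (_∈ edge i) (sym (x∈⁅y⁆⇒x≡y v u∈⁅v⁆)) (∈-comprehension⁻ (λ i → v ∈? edge i) i∈v)

  -- Invariant of the loop

  module _ (R : Subset n) (ε α : ℝ) where
    open State

    -- The first field keeps the terminal edges of all nodes of `R`, the second makes intersecting
    -- with `V_L` harmless on local hyperedges, and the third says that hyperedges touching `R` or
    -- an explored node are already local.
    record Invariant (σ : State H R ε α) : Set where
      field
        R⊆V_L    : R ⊆ V_L σ
        edge⊆V_L : ∀ {i} → i ∈ E_L σ → edge i ⊆ V_L σ
        E_L-R∪X  : ∀ {i v} → v ∈ R ∪ X σ → v ∈ edge i → i ∈ E_L σ

    open Invariant

    initial-invariant : Invariant (initial H R ε α)
    initial-invariant = record
      { R⊆V_L    = λ v∈R → x∈p∪q⁺ (inj₁ v∈R)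
      ; edge⊆V_L = λ i∈ u∈e → x∈p∪q⁺ (inj₂ (edge⊆neighboursOf R i∈ u∈e))
      ; E_L-R∪X  = λ v∈ v∈e → [ (λ v∈R → ∈-incidentTo⁺ R v∈R v∈e)
                              , (λ v∈⊥ → contradiction v∈⊥ ∉⊥) ]′ (x∈p∪q⁻ R ⊥ v∈)
      }

    expand-invariant : ∀ σ N → Invariant σ → Invariant (expand H R ε α σ N)
    expand-invariant σ N inv = record
      { R⊆V_L    = λ v∈R → x∈p∪q⁺ (inj₁ (R⊆V_L inv v∈R))
      ; edge⊆V_L = λ i∈ u∈e → x∈p∪q⁺
          ([ (λ i∈E_L → inj₁ (edge⊆V_L inv i∈E_L u∈e))
           , (λ i∈N → inj₂ (edge⊆neighboursOf N i∈N u∈e)) ]′ (x∈p∪q⁻ (E_L σ) _ i∈))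
      ; E_L-R∪X  = λ v∈ v∈e → x∈p∪q⁺
          ([ (λ v∈R → inj₁ (E_L-R∪X inv (x∈p∪q⁺ (inj₁ v∈R)) v∈e))
           , (λ v∈X∪N → [ (λ v∈X → inj₁ (E_L-R∪X inv (x∈p∪q⁺ (inj₂ v∈X)) v∈e))
                        , (λ v∈N → inj₂ (∈-incidentTo⁺ N v∈N v∈e)) ]′ (x∈p∪q⁻ (X σ) N v∈X∪N))
           ]′ (x∈p∪q⁻ R _ v∈))
      }

    -- A node of `S` outside both `R` and `X` would be a new node, which the stopping test rules
    -- out.
    newNodes-empty⇒⊆R∪X : ∀ σ S → Empty (newNodes H R ε α σ S) → S ⊆ R ∪ X σ
    newNodes-empty⇒⊆R∪X σ S empty {v} v∈S with v ∈? R | v ∈? X σ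
    ... | yes v∈R | _       = x∈p∪q⁺ (inj₁ v∈R)
    ... | no  _   | yes v∈X = x∈p∪q⁺ (inj₂ v∈X)
    ... | no  v∉R | no  v∉X = contradiction
      (v , x∈p∧x∉q⇒x∈p─q (x∈p∩q⁺ (v∈S , x∉p⇒x∈∁p v∉R)) v∉X) empty

    -- Comparison of cut values and global optimality

    module _ (0<ε : 0ᴿ <ᴿ ε) (0<α : 0ᴿ <ᴿ α) where

      -- `Hstcut` and `Lstcut` both have this shape by unfolding, so comparing them reduces to the
      -- hyperedge costs and two inclusions of node sets. Positive coefficients and nonnegative
      -- degrees do the rest.
      stcut-mono : ∀ c c′ (p p′ q q′ : Subset n) → c ≤ᴿ c′ → p ⊆ p′ → q ⊆ q′ →
        c +ᴿ α *ᴿ vol H p +ᴿ α *ᴿ ε *ᴿ vol H q ≤ᴿ c′ +ᴿ α *ᴿ vol H p′ +ᴿ α *ᴿ ε *ᴿ vol H q′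
      stcut-mono c c′ p p′ q q′ c≤c′ p⊆p′ q⊆q′ =
        +ᴿ-mono-≤ᴿ (c +ᴿ α *ᴿ vol H p) (c′ +ᴿ α *ᴿ vol H p′) (α *ᴿ ε *ᴿ vol H q) (α *ᴿ ε *ᴿ vol H q′)
          (+ᴿ-mono-≤ᴿ c c′ (α *ᴿ vol H p) (α *ᴿ vol H p′) c≤c′
            (*ᴿ-monoʳ-≤ᴿ α (vol H p) (vol H p′) 0<α (sumOver-mono-⊆ p p′ (degree H) degree-nonneg p⊆p′)))
          (*ᴿ-monoʳ-≤ᴿ (α *ᴿ ε) (vol H q) (vol H q′) (0<ᴿ-* α ε 0<α 0<ε)
            (sumOver-mono-⊆ q q′ (degree H) degree-nonneg q⊆q′))

      Hstcut≤Lstcut : ∀ σ S → Invariant σ → S ⊆ V_L σ → S ⊆ R ∪ X σ →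
        Hstcut H R ε α S ≤ᴿ Lstcut H R ε α σ S
      Hstcut≤Lstcut σ S inv S⊆V_L S⊆R∪X =
        stcut-mono (cut H S) (sumOver (E_L σ) wS)
          (∁ S ∩ R) ((V_L σ ∩ R) ∩ ∁ S) (S ∩ ∁ R) ((V_L σ ∩ ∁ R) ∩ S)
          (sumOver-mono ⊤ (E_L σ) wS wS
            (λ i _ _ → ≤ᴿ-refl (wS i))
            -- A hyperedge outside `E_L` cannot meet `S`, because a common node would lie in `R ∪ X`
            -- and force the hyperedge to be local. Its cost is therefore `w i ⊥`, which is zero.
            (λ i _ i∉E_L → ≤ᴿ-trans (wS i) (w i ⊥) 0ᴿ
              (≤ᴿ-reflexive (cong (w i) (Empty-unique (λ (v , v∈e∩S) →
                let v∈e , v∈S = x∈p∩q⁻ (edge i) S v∈e∩S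
                in i∉E_L (E_L-R∪X inv (S⊆R∪X v∈S) v∈e)))))
              (≈ᴿ⇒≤ᴿ (w i ⊥) 0ᴿ (w-∅ i)))
            (λ i i∉⊤ _ → contradiction ∈⊤ i∉⊤))
          (λ v∈ → let v∉S , v∈R = x∈p∩q⁻ (∁ S) R v∈
                  in x∈p∩q⁺ (x∈p∩q⁺ (R⊆V_L inv v∈R , v∈R) , v∉S))
          (λ v∈ → let v∈S , v∉R = x∈p∩q⁻ S (∁ R) v∈
                  in x∈p∩q⁺ (x∈p∩q⁺ (S⊆V_L v∈S , v∉R) , v∈S))
        where
        wS : Fin m → ℝ
        wS i = w i (edge i ∩ S)

      -- A local minimiser competes only with subsets of `V_L`, so an arbitrary `T` is represented
      -- by its trace `T ∩ V_L`.
      Lstcut≤Hstcut : ∀ σ T → Invariant σ →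
        Lstcut H R ε α σ (T ∩ V_L σ) ≤ᴿ Hstcut H R ε α T
      Lstcut≤Hstcut σ T inv =
        stcut-mono (sumOver (E_L σ) wL) (cut H T)
          ((V_L σ ∩ R) ∩ ∁ (T ∩ V_L σ)) (∁ T ∩ R) ((V_L σ ∩ ∁ R) ∩ (T ∩ V_L σ)) (T ∩ ∁ R)
          (sumOver-mono (E_L σ) ⊤ wL wT
            (λ i i∈E_L _ → ≤ᴿ-reflexive (cong (w i) (restrict i∈E_L)))
            (λ i _ i∉⊤ → contradiction ∈⊤ i∉⊤)
            -- Hyperedges outside `E_L` can only increase the global cut.
            (λ i _ _ → w-nonneg i (edge i ∩ T) (p∩q⊆p (edge i) T)))
          -- A node of `V_L` outside the trace is outside `T` itself.
          (λ v∈ → let v∈V_L∩R , v∉ = x∈p∩q⁻ (V_L σ ∩ R) _ v∈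
                      v∈V_L , v∈R = x∈p∩q⁻ (V_L σ) R v∈V_L∩R
                  in x∈p∩q⁺ (x∉p⇒x∈∁p (λ v∈T → x∈∁p⇒x∉p v∉ (x∈p∩q⁺ (v∈T , v∈V_L))) , v∈R))
          (λ v∈ → let v∈V_L∩∁R , v∈T∩V_L = x∈p∩q⁻ (V_L σ ∩ ∁ R) _ v∈
                  in x∈p∩q⁺ (p∩q⊆p T _ v∈T∩V_L , p∩q⊆q (V_L σ) (∁ R) v∈V_L∩∁R))
        where
        wL wT : Fin m → ℝ
        wL i = w i (edge i ∩ (T ∩ V_L σ))
        wT i = w i (edge i ∩ T)

        restrict : ∀ {i} → i ∈ E_L σ → edge i ∩ (T ∩ V_L σ) ≡ edge i ∩ T
        restrict {i} i∈E_L = ⊆-antisym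
          (λ v∈ → let v∈e , v∈T∩V_L = x∈p∩q⁻ (edge i) _ v∈
                  in x∈p∩q⁺ (v∈e , p∩q⊆p T _ v∈T∩V_L))
          (λ v∈ → let v∈e , v∈T = x∈p∩q⁻ (edge i) T v∈
                  in x∈p∩q⁺ (v∈e , x∈p∩q⁺ (v∈T , edge⊆V_L inv i∈E_L v∈e)))

      -- Induction on the run: `loop` passes the invariant to the expanded state, and `stop` places
      -- local minimality of `S` between the two comparisons.
      ⇓-argmin : ∀ σ {S} → Invariant σ → _⇓_ H R ε α σ S → S ∈argmin[ ⊤ ] Hstcut H R ε α
      ⇓-argmin σ {S} inv (stop (S⊆V_L , S-min) empty) = ⊆-max S , λ T _ →
        ≤ᴿ-trans (Hstcut H R ε α S) (Lstcut H R ε α σ S) (Hstcut H R ε α T)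
          (Hstcut≤Lstcut σ S inv S⊆V_L (newNodes-empty⇒⊆R∪X σ S empty))
          (≤ᴿ-trans (Lstcut H R ε α σ S) (Lstcut H R ε α σ (T ∩ V_L σ)) (Hstcut H R ε α T)
            (S-min (T ∩ V_L σ) (p∩q⊆q T (V_L σ)))
            (Lstcut≤Hstcut σ T inv))
      ⇓-argmin σ inv (loop {S} _ _ run) =
        ⇓-argmin (expand H R ε α σ N) (expand-invariant σ N inv) run
        where
        N : Subset n
        N = newNodes H R ε α σ S

theorem2 : ∀ {n m : ℕ} (H : Hypergraph n m) (R : Subset n) (ε α : ℝ) →
    0ᴿ <ᴿ ε → 0ᴿ <ᴿ α →
    ∀ (S_L : Subset n) → Algorithm2Returns H R ε α S_L →
    S_L ∈argmin[ ⊤ ] Hstcut H R ε α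
theorem2 H R ε α 0<ε 0<α S_L run =
  ⇓-argmin H R ε α 0<ε 0<α (initial H R ε α) (initial-invariant H R ε α) run
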